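{- Let $G=(V,E)$ be a graph with an odd number of vertices. Then $G$ is an $n$-convex geometry if and only if the following conditions both hold: (1) $G$ contains a unique star vertex $s$; (2) $G-\{s\}$ (the subgraph of $G$ induced by $V\setminus\{s\}$) is an $n$-convex geometry.
   Context: All graphs are finite, simple and undirected, with non-empty vertex set. For a graph $G=(V,E)$ and $x\in V$, the closed neighbourhood of $x$ is $N[x]=\{x\}\cup\{y\in V:\{x,y\}\in E\}$. A star (or star vertex) of $G$ is a vertex $s$ with $N[s]=V$. For $Y\subseteq V$, the common closed neighbourhood is $N[Y]=\bigcap_{y\in Y}N[y]$ if $Y\neq\varnothing$, and $N[\varnothing]=V$. The neighbourhood convexity of $G$ is the family $n_G=\{N[Y]:Y\subseteq V\}\cup\{\varnothing\}$ of subsets of $V$; it contains $\varnothing$ and $V$ and is closed under intersection. Its members are called $n$-convex sets. For $X\subseteq V$ the convex hull $[X]_{n}$ is the intersection of all $n$-convex sets containing $X$. For an $n$-convex set $K$, $\operatorname{ex}(K)=\{x\in K: K\setminus\{x\}\in n_G\}$ is the set of extreme points of $K$. $G$ is an $n$-convex geometry if $K=[\operatorname{ex}(K)]_{n}$ for every $n$-convex set $K$. -}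

module Defs where

open import Data.Fin.Base using (Fin; punchIn)
open import Data.Fin.Subset using (Subset; ⊤; ⊥; ⁅_⁆; _∪_; ⋂; _-_; _∈_)
open import Data.Fin.Subset.Properties using (_∈?_)
open import Data.List.Base using (map; filter; allFin)
open import Data.Nat.Base using (ℕ; suc)
open import Data.Product.Base using (_×_; ∃-syntax)
open import Data.Sum.Base using (_⊎_)
open import Data.Vec.Base using (tabulate)
open import Level using (0ℓ)
open import Relation.Binary.Core using (Rel)
open import Relation.Binary.Definitions using (Decidable; Irreflexive; Symmetric)
open import Relation.Binary.PropositionalEquality using (_≡_; refl)
open import Relation.Nullary.Decidable using (does)
open import Relation.Unary using (Pred; _≐_) renaming (_⊆_ to _⊆ₚ_)

-- The empty graph (n = 0) is not excluded here, so that deleting a vertex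
-- is always defined; non-emptiness is imposed by taking G : Graph (suc n).
record Graph (n : ℕ) : Set₁ where
  field
    Adj    : Rel (Fin n) 0ℓ
    adj?   : Decidable Adj
    sym    : Symmetric Adj
    irrefl : Irreflexive _≡_ Adj

module Neighbourhood {n : ℕ} (G : Graph n) where
  open Graph G

  N[_] : Fin n → Subset n
  N[ x ] = ⁅ x ⁆ ∪ tabulate (λ y → does (adj? x y))

  IsStar : Pred (Fin n) 0ℓ
  IsStar s = N[ s ] ≡ ⊤

  -- Since ⋂ [] = ⊤, this gives N[∅] = V.
  CN[_] : Subset n → Subset n
  CN[ Y ] = ⋂ (map N[_] (filter (_∈? Y) (allFin n)))

  Convex : Pred (Subset n) 0ℓ
  Convex K = (∃[ Y ] K ≡ CN[ Y ]) ⊎ K ≡ ⊥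

  hull : Pred (Fin n) 0ℓ → Pred (Fin n) 0ℓ
  hull X v = ∀ K → Convex K → X ⊆ₚ (_∈ K) → v ∈ K

  ex : Subset n → Pred (Fin n) 0ℓ
  ex K x = x ∈ K × Convex (K - x)

  IsConvexGeometry : Set
  IsConvexGeometry = ∀ K → Convex K → (_∈ K) ≐ hull (ex K)

open Neighbourhood public using (IsStar; IsConvexGeometry)

-- The subgraph induced on V ∖ {s}: punchIn s is the order-preserving
-- bijection from Fin n onto Fin (suc n) ∖ {s}.
_-ᵥ_ : ∀ {n} → Graph (suc n) → Fin (suc n) → Graph n
G -ᵥ s = record
  { Adj    = λ x y → Adj (punchIn s x) (punchIn s y)
  ; adj?   = λ x y → adj? (punchIn s x) (punchIn s y)
  ; sym    = sym
  ; irrefl = λ { refl → irrefl refl }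
  }
  where open Graph G

{-# OPTIONS --safe #-}

-- If G is an n-convex geometry without a star, then K ↦ N[K] is an antitone
-- involution of the n-convex sets. Removing one extreme point at a time gives
-- |K| + |N[K]| = |V| for every n-convex K, and a minimal n-convex K ⊇ N[K]
-- satisfies K = N[K]; hence |V| = 2|K| is even. So a geometry of odd order has
-- a star, and the set of all stars, being an atom of the convexity, is a
-- singleton {s}. When s is the only star, K ↦ K ∖ {s} and K' ↦ K' ∪ {s} are
-- mutually inverse between the non-empty n-convex sets of G and the n-convex
-- sets of G - s, and they respect extreme points other than s.
module Submission where

open import Defs
import Data.Bool.Properties as Bool
open import Data.Empty using (⊥-elim)
open import Data.Fin.Base using (Fin; zero; suc; punchIn; punchOut)
open import Data.Fin.Properties
  using (_≟_; any?; punchIn-injective; punchInᵢ≢i; punchIn-punchOut)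
open import Data.Fin.Subset
  using (Subset; inside; outside; ⊤; ⊥; ⋂; _─_; _-_; _∈_; _∉_; _⊆_; _⊂_; ∣_∣)
open import Data.Fin.Subset.Induction using (⊂-wellFounded)
open import Data.Fin.Subset.Properties
open import Data.List.Base using (List; []; _∷_; allFin)
open import Data.List.Membership.Propositional.Properties
  using (∈-map⁺; ∈-map⁻; ∈-filter⁺; ∈-filter⁻; ∈-allFin)
open import Data.List.Relation.Unary.All as All using (All; []; _∷_)
open import Data.Nat.Base using (ℕ; suc; _+_; _*_; _≤_; _<_; s≤s)
open import Data.Nat.Divisibility using (_∣_; _∤_; divides)
open import Data.Nat.Properties
  using (≤-trans; ≤-antisym; ≤-reflexive; +-mono-≤; +-monoˡ-≤; +-monoʳ-≤; +-suc;
         +-identityʳ; *-comm; m≤m+n; m≤n⇒m≤1+n; module ≤-Reasoning)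
open import Data.Product using (Σ-syntax; ∃!; ∃-syntax; _×_; _,_; proj₁; proj₂)
open import Data.Sum.Base using (_⊎_; inj₁; inj₂)
open import Data.Vec.Base using (_∷_; here; there; lookup; insertAt; removeAt)
open import Data.Vec.Properties
  using (≡-dec; lookup⇒[]=; []=⇒lookup; lookup∘tabulate; insertAt-lookup;
         insertAt-punchIn; insertAt-removeAt; removeAt-insertAt)
open import Function.Base using (_∘_)
open import Function.Bundles using (_⇔_; mk⇔)
open import Induction.WellFounded using (Acc; acc)
open import Relation.Binary.PropositionalEquality
  using (_≡_; _≢_; refl; sym; trans; cong; subst; module ≡-Reasoning)
open import Relation.Nullary.Decidable
  using (Dec; yes; no; dec-true; _×-dec_; _⊎-dec_; ¬?; decidable-stable)
open import Relation.Nullary.Negation using (¬_; contradiction)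

private variable
  n : ℕ
  x y : Fin n
  p q : Subset n

-- Finite subsets, intersections and deletion of an index.

x∈p─q⇒x∉q : ∀ (p q : Subset n) → x ∈ p ─ q → x ∉ q
x∈p─q⇒x∉q (_ ∷ p) (inside ∷ q) () here
x∈p─q⇒x∉q (_ ∷ p) (_ ∷ q) (there x∈p─q) (there x∈q) = x∈p─q⇒x∉q p q x∈p─q x∈q

x∉p-x : ∀ (p : Subset n) x → x ∉ p - x
x∉p-x p x x∈p-x = x∈p─q⇒x∉q p _ x∈p-x (x∈⁅x⁆ x)

p-x⊆p : ∀ (p : Subset n) x → p - x ⊆ p
p-x⊆p p x = p─q⊆p p _

p-x⊆q : (∀ {y} → y ∈ p → y ≢ x → y ∈ q) → p - x ⊆ q
p-x⊆q {p = p} {x = x} h y∈p-x =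
  h (p-x⊆p p x y∈p-x) λ { refl → x∉p-x p x y∈p-x }

∣p∣≤1+∣p-x∣ : ∀ (p : Subset n) x → ∣ p ∣ ≤ suc ∣ p - x ∣
∣p∣≤1+∣p-x∣ (inside  ∷ p) zero    = s≤s (≤-reflexive (cong ∣_∣ (sym (p─⊥≡p p))))
∣p∣≤1+∣p-x∣ (outside ∷ p) zero    =
  m≤n⇒m≤1+n (≤-reflexive (cong ∣_∣ (sym (p─⊥≡p p))))
∣p∣≤1+∣p-x∣ (inside  ∷ p) (suc x) = s≤s (∣p∣≤1+∣p-x∣ p x)
∣p∣≤1+∣p-x∣ (outside ∷ p) (suc x) = ∣p∣≤1+∣p-x∣ p x

⊈⇒∃∉ : ∀ (p q : Subset n) → ¬ p ⊆ q → ∃[ x ] x ∈ p × x ∉ q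
⊈⇒∃∉ p q p⊈q with any? (λ x → (x ∈? p) ×-dec ¬? (x ∈? q))
... | yes w = w
... | no ¬w = ⊥-elim (p⊈q
  λ {x} x∈p → decidable-stable (x ∈? q) λ x∉q → ¬w (x , x∈p , x∉q))

∈⋂⁺ : ∀ {ps : List (Subset n)} → All (x ∈_) ps → x ∈ ⋂ ps
∈⋂⁺ []           = ∈⊤
∈⋂⁺ (x∈p ∷ x∈ps) = x∈p∩q⁺ (x∈p , ∈⋂⁺ x∈ps)

∈⋂⁻ : ∀ (ps : List (Subset n)) → x ∈ ⋂ ps → All (x ∈_) ps
∈⋂⁻ []       _ = []
∈⋂⁻ (p ∷ ps) x∈ with x∈p , x∈ps ← x∈p∩q⁻ p (⋂ ps) x∈ = x∈p ∷ ∈⋂⁻ ps x∈ps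

punchIn-elim : ∀ (s : Fin (suc n)) (P : Fin (suc n) → Set) →
               P s → (∀ x → P (punchIn s x)) → ∀ y → P y
punchIn-elim s P Ps Pp y with s ≟ y
... | yes refl = Ps
... | no s≢y = subst P (punchIn-punchOut s≢y) (Pp (punchOut s≢y))

-- Common neighbourhoods as a polarity; extreme points and stars.

module Polarity (G : Graph n) where
  open Graph G using (Adj; adj?)
  open Neighbourhood G hiding (IsStar; IsConvexGeometry)

  ∈N⁻ : ∀ x → y ∈ N[ x ] → y ≡ x ⊎ Adj x y
  ∈N⁻ {y = y} x y∈ with x∈p∪q⁻ _ _ y∈
  ... | inj₁ y∈⁅x⁆ = inj₁ (x∈⁅y⁆⇒x≡y x y∈⁅x⁆)
  ... | inj₂ y∈adj with adj? x y | trans (sym (lookup∘tabulate _ y)) ([]=⇒lookup y∈adj)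
  ...   | yes xy | _ = inj₂ xy
  ...   | no _ | ()

  ∈N⁺ : ∀ x → y ≡ x ⊎ Adj x y → y ∈ N[ x ]
  ∈N⁺ x (inj₁ refl) = x∈p∪q⁺ (inj₁ (x∈⁅x⁆ x))
  ∈N⁺ {y = y} x (inj₂ xy) = x∈p∪q⁺ (inj₂ (lookup⇒[]= y _
    (trans (lookup∘tabulate _ y) (dec-true (adj? x y) xy))))

  N-refl : ∀ x → x ∈ N[ x ]
  N-refl x = ∈N⁺ x (inj₁ refl)

  N-sym : y ∈ N[ x ] → x ∈ N[ y ]
  N-sym {y} {x} y∈ with ∈N⁻ x y∈
  ... | inj₁ y≡x = ∈N⁺ y (inj₁ (sym y≡x))
  ... | inj₂ xy  = ∈N⁺ y (inj₂ (Graph.sym G xy))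

  star⁺ : (∀ y → y ∈ N[ x ]) → IsStar G x
  star⁺ h = ⊆-antisym (⊆-max _) (λ {y} _ → h y)

  star⁻ : IsStar G x → ∀ y → y ∈ N[ x ]
  star⁻ eq y = subst (y ∈_) (sym eq) ∈⊤

  ∈CN⁺ : ∀ Y → (∀ y → y ∈ Y → x ∈ N[ y ]) → x ∈ CN[ Y ]
  ∈CN⁺ Y h = ∈⋂⁺ (All.tabulate λ N∈ →
    let y , y∈ , eq = ∈-map⁻ N[_] N∈
    in subst (_ ∈_) (sym eq) (h y (proj₂ (∈-filter⁻ (_∈? Y) {xs = allFin n} y∈))))

  ∈CN⁻ : ∀ Y → x ∈ CN[ Y ] → y ∈ Y → x ∈ N[ y ]
  ∈CN⁻ {y = y} Y x∈ y∈Y =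
    All.lookup (∈⋂⁻ _ x∈) (∈-map⁺ N[_] (∈-filter⁺ (_∈? Y) (∈-allFin y) y∈Y))

  CN-antitone : p ⊆ q → CN[ q ] ⊆ CN[ p ]
  CN-antitone {p} {q} p⊆q x∈ = ∈CN⁺ p λ y y∈p → ∈CN⁻ q x∈ (p⊆q y∈p)

  -- Closed adjacency is symmetric, so `CN[_]` forms an antitone Galois connection with itself;
  -- `CN³` is the usual consequence.
  p⊆CN² : ∀ p → p ⊆ CN[ CN[ p ] ]
  p⊆CN² p x∈p = ∈CN⁺ CN[ p ] λ y y∈ → N-sym (∈CN⁻ p y∈ x∈p)

  CN³ : ∀ p → CN[ CN[ CN[ p ] ] ] ≡ CN[ p ]
  CN³ p = ⊆-antisym (CN-antitone (p⊆CN² p)) (p⊆CN² CN[ p ])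

  star∈CN : IsStar G x → ∀ Y → x ∈ CN[ Y ]
  star∈CN st Y = ∈CN⁺ Y λ y _ → N-sym (star⁻ st y)

  ∈CN⊤⇒star : x ∈ CN[ ⊤ ] → IsStar G x
  ∈CN⊤⇒star x∈ = star⁺ λ y → N-sym (∈CN⁻ ⊤ x∈ ∈⊤)

  -- Exhaustive search over subsets. It lets a failed inclusion produce an actual extreme point in
  -- `extreme-outside`.
  convex? : ∀ K → Dec (Convex K)
  convex? K = anySubset? (λ Y → K ≟ₛ CN[ Y ]) ⊎-dec (K ≟ₛ ⊥)
    where _≟ₛ_ = ≡-dec Bool._≟_

  -- Only one inclusion has content: `K` is itself a convex set containing `ex K`, so it contains
  -- the hull.
  geometry⁺ : (∀ {K C} → Convex K → Convex C → (∀ {x} → ex K x → x ∈ C) → K ⊆ C) →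
              IsConvexGeometry G
  geometry⁺ h K cK =
    (λ v∈K C cC exK⊆C → h cK cC exK⊆C v∈K) , (λ v∈hull → v∈hull K cK proj₁)

  geometry⁻ : IsConvexGeometry G →
              ∀ {K C} → Convex K → Convex C → (∀ {x} → ex K x → x ∈ C) → K ⊆ C
  geometry⁻ geo {K} {C} cK cC exK⊆C v∈K = proj₁ (geo K cK) v∈K C cC exK⊆C

  -- If all extreme points of `K` lay in `C`, so would their hull, which is `K`.
  extreme-outside : IsConvexGeometry G → ∀ {K C} → Convex K → Convex C → ¬ K ⊆ C →
                    ∃[ x ] x ∉ C × ex K x
  extreme-outside geo {K} {C} cK cC K⊈C
    with any? (λ x → ¬? (x ∈? C) ×-dec ((x ∈? K) ×-dec convex? (K - x)))
  ... | yes w = w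
  ... | no ¬w = ⊥-elim (K⊈C
    (geometry⁻ geo cK cC λ {x} exx → decidable-stable (x ∈? C) λ x∉C → ¬w (x , x∉C , exx)))

  -- `CN[ ⊤ ]` is the set of stars. With two stars it has no extreme point, so as the hull of
  -- nothing it lies in the convex set `⊥`.
  star-unique : IsConvexGeometry G → IsStar G x → IsStar G y → x ≡ y
  star-unique {x} {y} geo sx sy with x ≟ y
  ... | yes x≡y = x≡y
  ... | no x≢y = contradiction
        (geometry⁻ geo (inj₁ (⊤ , refl)) (inj₂ refl) (⊥-elim ∘ no-extreme) (star∈CN sx ⊤)) ∉⊥
    where
    -- A deleted point is a star, hence in every `CN[ Y ]`, so the remainder is no `CN[ Y ]`; it is
    -- not `⊥` either, since `x` or `y` survives.
    no-extreme : ∀ {z} → ¬ ex CN[ ⊤ ] z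
    no-extreme {z} (z∈ , inj₁ (Y , eq)) =
      x∉p-x CN[ ⊤ ] z (subst (z ∈_) (sym eq) (star∈CN (∈CN⊤⇒star z∈) Y))
    no-extreme {z} (z∈ , inj₂ eq) with x ≟ z
    ... | no x≢z   = ∉⊥ (subst (x ∈_) eq (x∈p∧x≢y⇒x∈p-y (star∈CN sx ⊤) x≢z))
    ... | yes refl = ∉⊥ (subst (y ∈_) eq (x∈p∧x≢y⇒x∈p-y (star∈CN sy ⊤) (x≢y ∘ sym)))

-- Geometries without a star have even order.

module Starless (G : Graph n) (geo : IsConvexGeometry G) (starless : ∀ x → ¬ IsStar G x) where
  open Neighbourhood G hiding (IsStar; IsConvexGeometry)
  open Polarity G

  CN⊤≡⊥ : CN[ ⊤ ] ≡ ⊥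
  CN⊤≡⊥ = Empty-unique λ (x , x∈) → starless x (∈CN⊤⇒star x∈)

  -- Without stars `⊥` is `CN[ ⊤ ]`, so every convex set is some `CN[ Y ]` and `CN³` applies.
  CN²-convex : ∀ {K} → Convex K → CN[ CN[ K ] ] ≡ K
  CN²-convex (inj₁ (Y , refl)) = CN³ Y
  CN²-convex (inj₂ refl) = subst (λ p → CN[ CN[ p ] ] ≡ p) CN⊤≡⊥ (CN³ ⊤)

  ∣CN∣-grows : ∀ {K x} → Convex K → ex K x → ∣ CN[ K ] ∣ < ∣ CN[ K - x ] ∣
  ∣CN∣-grows {K} {x} cK (x∈K , cK-x) =
    p⊂q⇒∣p∣<∣q∣ (CN-antitone (p-x⊆p K x) , ⊈⇒∃∉ _ _ not-⊆)
    where
    not-⊆ : ¬ CN[ K - x ] ⊆ CN[ K ]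
    -- Applying `CN[_]` to `h` would put `x` into the double polar of `K - x`, which is `K - x`.
    not-⊆ h = x∉p-x K x (subst (x ∈_) (CN²-convex cK-x) (CN-antitone h (p⊆CN² K x∈K)))

  ∣K∣+∣CN∣-grows : ∀ {K x} → Convex K → ex K x →
                   ∣ K ∣ + ∣ CN[ K ] ∣ ≤ ∣ K - x ∣ + ∣ CN[ K - x ] ∣
  ∣K∣+∣CN∣-grows {K} {x} cK exx = begin
    ∣ K ∣ + ∣ CN[ K ] ∣             ≤⟨ +-monoˡ-≤ _ (∣p∣≤1+∣p-x∣ K x) ⟩
    suc (∣ K - x ∣ + ∣ CN[ K ] ∣)   ≡⟨ +-suc _ _ ⟨
    ∣ K - x ∣ + suc ∣ CN[ K ] ∣     ≤⟨ +-monoʳ-≤ ∣ K - x ∣ (∣CN∣-grows cK exx) ⟩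
    ∣ K - x ∣ + ∣ CN[ K - x ] ∣     ∎
    where open ≤-Reasoning

  -- Strip extreme points down to the empty set: the sum never decreases on the way and ends at no
  -- more than `0 + n`.
  ∣K∣+∣CN∣≤n : ∀ {K} → Convex K → ∣ K ∣ + ∣ CN[ K ] ∣ ≤ n
  ∣K∣+∣CN∣≤n {K} cK = go (⊂-wellFounded K) cK
    where
    go : ∀ {K} → Acc _⊂_ K → Convex K → ∣ K ∣ + ∣ CN[ K ] ∣ ≤ n
    go {K} (acc rec) cK with K ⊆? ⊥
    ... | yes K⊆⊥ = +-mono-≤ (≤-trans (p⊆q⇒∣p∣≤∣q∣ K⊆⊥) (≤-reflexive (∣⊥∣≡0 n))) (∣p∣≤n CN[ K ])
    ... | no K⊈⊥ with x , _ , exx@(x∈K , cK-x) ← extreme-outside geo cK (inj₂ refl) K⊈⊥ =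
      ≤-trans (∣K∣+∣CN∣-grows cK exx) (go (rec (x∈p⇒p-x⊂p x∈K)) cK-x)

  -- Descent from `⊤`, deleting extreme points outside `CN[ K ]` while keeping `CN[ K ] ⊆ K`; it can
  -- only stop at equality. The lower bound holds at `⊤` and is carried along.
  self-polar : ∃[ K ] Convex K × CN[ K ] ≡ K × n ≤ ∣ K ∣ + ∣ CN[ K ] ∣
  self-polar = go (⊂-wellFounded ⊤) (inj₁ (⊥ , ⊤≡CN⊥)) (⊆-max _)
    (≤-trans (≤-reflexive (sym (∣⊤∣≡n n))) (m≤m+n ∣ ⊤ {n} ∣ _))
    where
    ⊤≡CN⊥ : ⊤ ≡ CN[ ⊥ ]
    ⊤≡CN⊥ = ⊆-antisym (λ _ → ∈CN⁺ ⊥ λ y y∈⊥ → contradiction y∈⊥ ∉⊥) (⊆-max _)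

    go : ∀ {K} → Acc _⊂_ K → Convex K → CN[ K ] ⊆ K → n ≤ ∣ K ∣ + ∣ CN[ K ] ∣ →
         ∃[ L ] Convex L × CN[ L ] ≡ L × n ≤ ∣ L ∣ + ∣ CN[ L ] ∣
    go {K} (acc rec) cK CN⊆K n≤ with K ⊆? CN[ K ]
    ... | yes K⊆CN = K , cK , ⊆-antisym CN⊆K K⊆CN , n≤
    ... | no K⊈CN
      with x , x∉CN , exx@(x∈K , cK-x) ← extreme-outside geo cK (inj₁ (K , refl)) K⊈CN =
        go (rec (x∈p⇒p-x⊂p x∈K)) cK-x CN[K-x]⊆K-x (≤-trans n≤ (∣K∣+∣CN∣-grows cK exx))
      where
      CN[K]⊆K-x : CN[ K ] ⊆ K - x
      CN[K]⊆K-x y∈ = x∈p∧x≢y⇒x∈p-y (CN⊆K y∈) λ { refl → x∉CN y∈ }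

      -- Since `x` is in its own closed neighbourhood, membership here would already give
      -- `x ∈ CN[ K ]`.
      x∉CN[K-x] : x ∉ CN[ K - x ]
      x∉CN[K-x] x∈ = x∉CN (∈CN⁺ K λ y y∈K → adjacent y y∈K (y ≟ x))
        where
        adjacent : ∀ y → y ∈ K → Dec (y ≡ x) → x ∈ N[ y ]
        adjacent y _   (yes refl) = N-refl y
        adjacent y y∈K (no y≢x)   = ∈CN⁻ (K - x) x∈ (x∈p∧x≢y⇒x∈p-y y∈K y≢x)

      -- Taking polars in `CN[ K ] ⊆ K - x` gives `CN[ K - x ] ⊆ K`, and `x` was just excluded.
      CN[K-x]⊆K-x : CN[ K - x ] ⊆ K - x
      CN[K-x]⊆K-x y∈ = x∈p∧x≢y⇒x∈p-y
        (subst (_ ∈_) (CN²-convex cK) (CN-antitone CN[K]⊆K-x y∈))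
        λ { refl → x∉CN[K-x] y∈ }

  even-order : 2 ∣ n
  even-order with K , cK , CN≡K , n≤ ← self-polar = divides ∣ K ∣ (begin
    n                     ≡⟨ ≤-antisym n≤ (∣K∣+∣CN∣≤n cK) ⟩
    ∣ K ∣ + ∣ CN[ K ] ∣   ≡⟨ cong (λ p → ∣ K ∣ + ∣ p ∣) CN≡K ⟩
    ∣ K ∣ + ∣ K ∣         ≡⟨ cong (∣ K ∣ +_) (+-identityʳ _) ⟨
    2 * ∣ K ∣             ≡⟨ *-comm 2 ∣ K ∣ ⟩
    ∣ K ∣ * 2             ∎)
    where open ≡-Reasoning

-- Transfer of vertex sets: dropping and adding `s`.

module Restriction (s : Fin (suc n)) where

  restrict : Subset (suc n) → Subset n
  restrict K = removeAt K s

  extend : Subset n → Subset (suc n)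
  extend K = insertAt K s inside

  s∈extend : ∀ K → s ∈ extend K
  s∈extend K = lookup⇒[]= s _ (insertAt-lookup K s inside)

  ∈extend⁺ : ∀ {K} → x ∈ K → punchIn s x ∈ extend K
  ∈extend⁺ {x = x} {K} x∈K = lookup⇒[]= _ _ (trans (insertAt-punchIn K s inside x) ([]=⇒lookup x∈K))

  ∈extend⁻ : ∀ {K} → punchIn s x ∈ extend K → x ∈ K
  ∈extend⁻ {x = x} {K} px∈ =
    lookup⇒[]= x K (trans (sym (insertAt-punchIn K s inside x)) ([]=⇒lookup px∈))

  restrict-extend : ∀ K → restrict (extend K) ≡ K
  restrict-extend K = removeAt-insertAt K s inside

  extend-restrict : ∀ {K} → s ∈ K → extend (restrict K) ≡ K
  extend-restrict {K} s∈K =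
    trans (cong (insertAt (restrict K) s) (sym ([]=⇒lookup s∈K))) (insertAt-removeAt K s)

  lookup-restrict : ∀ K x → lookup (restrict K) x ≡ lookup K (punchIn s x)
  lookup-restrict K x = trans (sym (insertAt-punchIn (restrict K) s (lookup K s) x))
    (cong (λ L → lookup L (punchIn s x)) (insertAt-removeAt K s))

  ∈restrict⁺ : ∀ {K} → punchIn s x ∈ K → x ∈ restrict K
  ∈restrict⁺ {x = x} {K} px∈ = lookup⇒[]= x _ (trans (lookup-restrict K x) ([]=⇒lookup px∈))

  ∈restrict⁻ : ∀ {K} → x ∈ restrict K → punchIn s x ∈ K
  ∈restrict⁻ {x = x} {K} x∈ = lookup⇒[]= _ K (trans (sym (lookup-restrict K x)) ([]=⇒lookup x∈))

  restrict-- : ∀ K x → restrict (K - punchIn s x) ≡ restrict K - x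
  restrict-- K x = ⊆-antisym
    (λ y∈ → let py∈ = ∈restrict⁻ y∈ in
      x∈p∧x≢y⇒x∈p-y (∈restrict⁺ (p-x⊆p K _ py∈)) λ { refl → x∉p-x K _ py∈ })
    (p-x⊆q {p = restrict K} λ y∈ y≢x → ∈restrict⁺ {K = K - punchIn s x}
      (x∈p∧x≢y⇒x∈p-y (∈restrict⁻ y∈) (y≢x ∘ punchIn-injective s _ _)))

  extend-restrict-- : ∀ {K} → s ∈ K → ∀ x → extend (restrict K - x) ≡ K - punchIn s x
  extend-restrict-- {K} s∈K x = trans (cong extend (sym (restrict-- K x)))
    (extend-restrict (x∈p∧x≢y⇒x∈p-y s∈K (punchInᵢ≢i s x ∘ sym)))

-- Convex sets and extreme points under deletion of a star.

module StarDeletion (G : Graph (suc n)) (s : Fin (suc n)) (star : IsStar G s) where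
  open Restriction s
  private
    module P  = Polarity G
    module P′ = Polarity (G -ᵥ s)
    module N  = Neighbourhood G
    module N′ = Neighbourhood (G -ᵥ s)

  ∈N-punchIn⁺ : ∀ y → x ∈ N′.N[ y ] → punchIn s x ∈ N.N[ punchIn s y ]
  ∈N-punchIn⁺ y x∈ with P′.∈N⁻ y x∈
  ... | inj₁ refl = P.N-refl _
  ... | inj₂ yx   = P.∈N⁺ _ (inj₂ yx)

  ∈N-punchIn⁻ : ∀ y → punchIn s x ∈ N.N[ punchIn s y ] → x ∈ N′.N[ y ]
  ∈N-punchIn⁻ y px∈ with P.∈N⁻ _ px∈
  ... | inj₁ eq = P′.∈N⁺ y (inj₁ (punchIn-injective s _ _ eq))
  ... | inj₂ yx = P′.∈N⁺ y (inj₂ yx)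

  restrict-CN : ∀ Y → restrict N.CN[ Y ] ≡ N′.CN[ restrict Y ]
  restrict-CN Y = ⊆-antisym
    (λ x∈ → P′.∈CN⁺ _ λ y y∈ →
      ∈N-punchIn⁻ y (P.∈CN⁻ Y (∈restrict⁻ x∈) (∈restrict⁻ y∈)))
    (λ {x} x∈ → ∈restrict⁺ (P.∈CN⁺ Y (punchIn-elim s _
      -- If `s ∈ Y`, it imposes no condition, because every vertex is in `N[ s ]`.
      (λ _ → P.star⁻ star _)
      (λ y py∈ → ∈N-punchIn⁺ y (P′.∈CN⁻ _ x∈ (∈restrict⁺ py∈))))))

  extend-CN : ∀ Y → extend N′.CN[ Y ] ≡ N.CN[ extend Y ]
  extend-CN Y = begin
    extend N′.CN[ Y ]                       ≡⟨ cong (λ Z → extend N′.CN[ Z ]) (restrict-extend Y) ⟨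
    extend N′.CN[ restrict (extend Y) ]     ≡⟨ cong extend (restrict-CN (extend Y)) ⟨
    extend (restrict N.CN[ extend Y ])      ≡⟨ extend-restrict (P.star∈CN star (extend Y)) ⟩
    N.CN[ extend Y ]                        ∎
    where open ≡-Reasoning

  restrict⊥⊆ : ∀ {K : Subset n} → restrict ⊥ ⊆ K
  restrict⊥⊆ x∈ = contradiction (∈restrict⁻ x∈) ∉⊥

  restrict-convex : ∀ {K} → N.Convex K → N′.Convex (restrict K)
  restrict-convex (inj₁ (Y , refl)) = inj₁ (restrict Y , restrict-CN Y)
  restrict-convex (inj₂ refl)       = inj₂ (⊆-antisym restrict⊥⊆ (⊆-min _))

  module _ (unique : ∀ {t} → IsStar G t → s ≡ t) where

    -- This is where uniqueness enters: the singleton of `s` is convex because it is the set of all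
    -- stars.
    extend⊥ : extend ⊥ ≡ N.CN[ ⊤ ]
    extend⊥ = ⊆-antisym
      (λ {x} → punchIn-elim s (λ x → x ∈ extend ⊥ → x ∈ N.CN[ ⊤ ])
        (λ _ → P.star∈CN star ⊤) (λ x px∈ → contradiction (∈extend⁻ px∈) ∉⊥) x)
      (λ x∈ → subst (_∈ extend ⊥) (unique (P.∈CN⊤⇒star x∈)) (s∈extend ⊥))

    extend-convex : ∀ {K} → N′.Convex K → N.Convex (extend K)
    extend-convex (inj₁ (Y , refl)) = inj₁ (extend Y , extend-CN Y)
    extend-convex (inj₂ refl)       = inj₁ (⊤ , extend⊥)

    geometry-delete : IsConvexGeometry G → IsConvexGeometry (G -ᵥ s)
    geometry-delete geo = P′.geometry⁺ λ {K} {C} cK cC exK⊆C v∈K →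
      ∈extend⁻ (P.geometry⁻ geo (extend-convex cK) (extend-convex cC)
        (λ {x} → punchIn-elim s (λ x → N.ex (extend K) x → x ∈ extend C)
          -- Whether or not `s` is extreme in `extend K`, it lies in `extend C`; every other extreme
          -- point comes from one of `K`.
          (λ _ → s∈extend C)
          (λ x (px∈ , cK-px) → ∈extend⁺ (exK⊆C (∈extend⁻ px∈ ,
            subst N′.Convex (trans (restrict-- (extend K) x) (cong (_- x) (restrict-extend K)))
              (restrict-convex cK-px))))
          x)
        (∈extend⁺ v∈K))

    geometry-restore : IsConvexGeometry (G -ᵥ s) → IsConvexGeometry G
    geometry-restore geo = P.geometry⁺ ⊆-hull
      where
      s∈C : ∀ {K C} → N.Convex C → s ∈ K → (∀ {x} → N.ex K x → x ∈ C) →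
            restrict K ⊆ restrict C → s ∈ C
      s∈C (inj₁ (Z , refl)) _ _ _ = P.star∈CN star Z
      -- With `C` empty, `K` has no vertex besides `s`, so `K - s` is `⊥` and `s` is extreme; hence
      -- `s` lies in `C` by assumption.
      s∈C {K} (inj₂ refl) s∈K exK⊆⊥ rK⊆r⊥ = exK⊆⊥ (s∈K , inj₂ (⊆-antisym
        (p-x⊆q λ {y} → punchIn-elim s (λ y → y ∈ K → y ≢ s → y ∈ ⊥)
          (λ _ s≢s → contradiction refl s≢s)
          (λ x px∈ _ → ∈restrict⁻ (rK⊆r⊥ (∈restrict⁺ px∈)))
          y)
        (⊆-min _)))

      ⊆-hull : ∀ {K C} → N.Convex K → N.Convex C → (∀ {x} → N.ex K x → x ∈ C) → K ⊆ C
      -- The empty set is treated apart; any other convex set is a `CN[ Y ]`, which contains `s` and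
      -- so is recovered from its restriction.
      ⊆-hull (inj₂ refl) _ _ v∈⊥ = contradiction v∈⊥ ∉⊥
      ⊆-hull {K} {C} cK@(inj₁ (Y , refl)) cC exK⊆C {v} = punchIn-elim s (λ v → v ∈ K → v ∈ C)
        (λ s∈K → s∈C cC s∈K exK⊆C rK⊆rC)
        (λ x px∈ → ∈restrict⁻ (rK⊆rC (∈restrict⁺ px∈)))
        v
        where
        rK⊆rC : restrict K ⊆ restrict C
        rK⊆rC = P′.geometry⁻ geo (restrict-convex cK) (restrict-convex cC)
          λ {x} (x∈ , cK-x) → ∈restrict⁺ (exK⊆C (∈restrict⁻ x∈ ,
            subst N.Convex (extend-restrict-- (P.star∈CN star Y) x) (extend-convex cK-x)))

-- Odd order: existence of a star and both implications.

proposition39 : ∀ {n : ℕ} (G : Graph (suc n)) → 2 ∤ suc n →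
    IsConvexGeometry G ⇔
    (Σ[ (s , _) ∈ ∃! _≡_ (IsStar G) ] IsConvexGeometry (G -ᵥ s))
proposition39 G odd = mk⇔ to λ ((s , star , unique) , geo) →
    StarDeletion.geometry-restore G s star unique geo
  where
  to : IsConvexGeometry G → Σ[ (s , _) ∈ ∃! _≡_ (IsStar G) ] IsConvexGeometry (G -ᵥ s)
  to geo with any? (λ s → ≡-dec Bool._≟_ (Neighbourhood.N[_] G s) ⊤)
  ... | no ∄star = contradiction
    (Starless.even-order G geo λ s star → ∄star (s , star)) odd
  ... | yes (s , star) =
    (s , star , unique) , StarDeletion.geometry-delete G s star unique geo
    where
    unique : ∀ {t} → IsStar G t → s ≡ t
    unique = Polarity.star-unique G geo star
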